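{- Let $\mu\ge 3$ be an integer, let $\mathfrak{t}_\mu$ be the Hecke triangle group generated by $Tz=z+\varpi_\mu$, $\varpi_\mu=2\cos(\pi/\mu)$, and $Sz=-1/z$, and let $U=U_{\mathfrak{t}_\mu,w,r}$ be a quasiautomorphic form of weight $w$ and depth $r$ ($0\le r\le w/2$) with respect to $\mathfrak{t}_\mu$. Let $\mathbf{F}_U$ be the Hecke vector-form of $U$ and let $A_r$ be the $(r+1)\times(r+1)$ creation matrix. Then for $z\in\mathbb{H}$, $$\mathbf{F}_U(Tz)=e^{\varpi_\mu A_r}\,\mathbf{F}_U(z).$$
   Context: $\mathbb{H}$ is the upper half-plane. $\mathcal{A}_k(\mathfrak{t}_\mu)$ is the vector space of automorphic forms of weight $k$ with respect to $\mathfrak{t}_\mu$: functions $H$ holomorphic on $\mathbb{H}$ and at the cusp $i\infty$ with $H(Tz)=H(z)$ and $H(Sz)=z^kH(z)$. $E_2=E_{\mathfrak{t}_\mu,2}$ is the weight $2$ (quasiautomorphic) Eisenstein series for $\mathfrak{t}_\mu$, which is holomorphic on $\mathbb{H}$ and periodic under $T$. $C=C_{\mathfrak{t}_\mu}$ is the unique structure constant associated to $E_2$, i.e. $\lim_{z\to i\infty}E_2(z)=C$. A quasiautomorphic form of weight $w$ ($w\ge 2$ an even integer) and depth $r$ (an integer with $0\le r\le w/2$) is a function $U(z)=\sum_{k=0}^r H_{w-2k}(z)E_2(z)^k$ with $H_{w-2k}\in\mathcal{A}_{w-2k}(\mathfrak{t}_\mu)$. Write $B_{U,k}:=H_{w-2k}$.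 For $0\le \ell\le r$ and $m\ge 0$ put $\{r,\ell\}_m:=\frac{(m+\ell)!\,(r-\ell)!}{m!\,r!}$, and define $$g_\ell(z):=C^\ell\sum_{m=0}^{r-\ell}\{r,\ell\}_m\,B_{U,\ell+m}(z)\,E_2(z)^m\quad(0\le\ell\le r),\qquad f_n(z):=\sum_{k=0}^n\binom{n}{k}g_k(z)\,z^{n-k}\quad(0\le n\le r).$$ The Hecke vector-form of $U$ is the column vector $\mathbf{F}_U(z):=(f_0(z),f_1(z),\dots,f_r(z))^{\mathbf t}$. The creation matrix $A_r$ is the $(r+1)\times(r+1)$ matrix, rows and columns indexed by $0,\dots,r$, whose $(i,i-1)$ entry is $i$ for $1\le i\le r$ and whose other entries are $0$. $e^M=\sum_{n\ge 0}M^n/n!$ is the matrix exponential. -}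

module Defs where

open import Algebra.Apartness.Bundles using (HeytingField; HeytingCommutativeRing)
open import Algebra.Bundles using (CommutativeRing; Semiring)
open import Algebra.Bundles.Raw using (RawSemiring)
open import Data.Bool.Base using (if_then_else_)
open import Data.Empty using (⊥-elim)
open import Data.Fin.Base using (Fin; toℕ; fromℕ<; inject≤)
open import Data.Fin.Properties using (toℕ<n; toℕ≤pred[n])
open import Data.Nat.Base as ℕ using (ℕ; zero; suc; NonZero; _∸_; _!)
open import Data.Nat.Combinatorics using () renaming (_C_ to _choose_)
import Data.Nat.Properties as ℕ
open import Data.Product.Base using (Σ; ∃-syntax; Σ-syntax; _×_; _,_; proj₁; proj₂)
open import Data.Sum.Base using (_⊎_; inj₁; inj₂)
open import Data.Vec.Functional using (Vector)
open import Function.Bundles using (Func; _⇔_; module Equivalence)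
open import Level using (Level; _⊔_)
open import Relation.Binary.Bundles using (Setoid)
open import Relation.Binary.PropositionalEquality.Core as ≡ using ()
open import Relation.Binary.Structures using (IsStrictPartialOrder)
open import Relation.Nullary.Decidable.Core using (⌊_⌋)
open import Relation.Nullary.Negation.Core using (¬_)
open import Relation.Unary using (Pred)
import Algebra.Definitions.RawSemiring as SemiringDefs
import Algebra.Properties.Ring as RingProperties
import Algebra.Apartness.Properties.HeytingCommutativeRing as HCRProperties
import Relation.Binary.Reasoning.Setoid as SetoidReasoning

-- The real numbers, characterised as a Cauchy-complete Archimedean ordered
-- field.  Apartness x # y is the positive form of x ≠ y; the constructive
-- Cauchy reals are a model, and classically ℝ is the only one up to isomorphism.

record RealNumbers c ℓ₁ ℓ₂ ℓ₃ : Set (Level.suc (c ⊔ ℓ₁ ⊔ ℓ₂ ⊔ ℓ₃)) where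
  infix 4 _<_ _≤_

  field
    heytingField : HeytingField c ℓ₁ ℓ₂

  open HeytingField heytingField public renaming (Carrier to ℝ)

  commutativeRing : CommutativeRing c ℓ₁
  commutativeRing = HeytingCommutativeRing.commutativeRing heytingCommutativeRing

  open CommutativeRing commutativeRing public using (ring; semiring)
  open Semiring semiring public using (rawSemiring)
  open SemiringDefs rawSemiring public using (_^_; sum) renaming (_×_ to _⋆_)

  fromℕ : ℕ → ℝ
  fromℕ n = n ⋆ 1#

  field
    _<_                  : ℝ → ℝ → Set ℓ₃
    isStrictPartialOrder : IsStrictPartialOrder _≈_ _<_
    #⇔<⊎>                : ∀ {x y} → (x # y) ⇔ (x < y ⊎ y < x)
    +-monoʳ-<            : ∀ z {x y} → x < y → z + x < z + y
    *-pos                : ∀ {x y} → 0# < x → 0# < y → 0# < x * y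
    archimedean          : ∀ x → ∃[ n ] x < fromℕ n

  _≤_ : ℝ → ℝ → Set ℓ₃
  x ≤ y = ¬ (y < x)

  -- ∣ x - y ∣ < ε
  Within : ℝ → ℝ → ℝ → Set ℓ₃
  Within ε x y = (x - y < ε) × (y - x < ε)

  Cauchy : (ℕ → ℝ) → Set (c ⊔ ℓ₃)
  Cauchy s = ∀ ε → 0# < ε →
    ∃[ N ] (∀ m n → N ℕ.≤ m → N ℕ.≤ n → Within ε (s m) (s n))

  ConvergesTo : (ℕ → ℝ) → ℝ → Set (c ⊔ ℓ₃)
  ConvergesTo s x = ∀ ε → 0# < ε →
    ∃[ N ] (∀ n → N ℕ.≤ n → Within ε (s n) x)

  field
    complete : ∀ s → Cauchy s → ∃[ x ] ConvergesTo s x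

  open IsStrictPartialOrder isStrictPartialOrder public
    using (<-resp-≈; <-respˡ-≈; <-respʳ-≈) renaming (irrefl to <-irrefl; trans to <-trans)

module RealProperties {c ℓ₁ ℓ₂ ℓ₃} (R : RealNumbers c ℓ₁ ℓ₂ ℓ₃) where
  open RealNumbers R
  open RingProperties ring using (-‿distribˡ-*; -‿distribʳ-*; -‿involutive)
  open HCRProperties heytingCommutativeRing using (1#0; x-0≈x; invertibleˡ⇒#)
  open SetoidReasoning setoid

  +-monoˡ-< : ∀ z {x y} → x < y → x + z < y + z
  +-monoˡ-< z x<y = <-respˡ-≈ (+-comm z _) (<-respʳ-≈ (+-comm z _) (+-monoʳ-< z x<y))

  <-cotrans : ∀ {x y} → x < y → ∀ z → x < z ⊎ z < y
  <-cotrans {x} {y} x<y z with #-cotrans (Equivalence.from #⇔<⊎> (inj₁ x<y)) z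
  ... | inj₁ x#z with Equivalence.to #⇔<⊎> x#z
  ...   | inj₁ x<z = inj₁ x<z
  ...   | inj₂ z<x = inj₂ (<-trans z<x x<y)
  <-cotrans {x} {y} x<y z | inj₂ z#y with Equivalence.to #⇔<⊎> z#y
  ...   | inj₁ z<y = inj₂ z<y
  ...   | inj₂ y<z = inj₁ (<-trans x<y y<z)

  neg-pos : ∀ {x} → x < 0# → 0# < - x
  neg-pos {x} x<0 =
    <-respˡ-≈ (-‿inverseˡ x) (<-respʳ-≈ (+-identityʳ (- x)) (+-monoʳ-< (- x) x<0))

  -x*-x≈x*x : ∀ x → - x * - x ≈ x * x
  -x*-x≈x*x x = begin
    - x * - x      ≈⟨ -‿distribˡ-* x (- x) ⟨
    - (x * - x)    ≈⟨ -‿cong (-‿distribʳ-* x x) ⟨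
    - - (x * x)    ≈⟨ -‿involutive (x * x) ⟩
    x * x          ∎

  #0⇒square-pos : ∀ {x} → x # 0# → 0# < x * x
  #0⇒square-pos {x} x#0 with Equivalence.to #⇔<⊎> x#0
  ... | inj₁ x<0 = <-respʳ-≈ (-x*-x≈x*x x) (*-pos (neg-pos x<0) (neg-pos x<0))
  ... | inj₂ 0<x = *-pos 0<x 0<x

  0<1 : 0# < 1#
  0<1 = <-respʳ-≈ (*-identityˡ 1#) (#0⇒square-pos 1#0)

  inverseˡ⇒#0 : ∀ {x y} → y * x ≈ 1# → x # 0#
  inverseˡ⇒#0 {x} {y} yx≈1 = invertibleˡ⇒# (y , trans (*-congˡ (x-0≈x x)) yx≈1)

  inverse : ∀ x → 0# < x → ∃[ y ] y * x ≈ 1#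
  inverse x 0<x with #⇒invertible (Equivalence.from #⇔<⊎> (inj₂ 0<x))
  ... | y , y*[x-0]≈1 , _ = y , trans (*-congˡ (sym (x-0≈x x))) y*[x-0]≈1

  inverse-pos : ∀ {x y} → 0# < x → y * x ≈ 1# → 0# < y
  inverse-pos {x} {y} 0<x yx≈1
    with Equivalence.to #⇔<⊎> (inverseˡ⇒#0 (trans (*-comm x y) yx≈1))
  ... | inj₂ 0<y = 0<y
  ... | inj₁ y<0 = ⊥-elim (<-irrefl refl (<-trans 0<1 1<0))
    where
    0<-1 : 0# < - 1#
    0<-1 = <-respʳ-≈ (trans (sym (-‿distribˡ-* y x)) (-‿cong yx≈1)) (*-pos (neg-pos y<0) 0<x)
    1<0 : 1# < 0#
    1<0 = <-respˡ-≈ (+-identityʳ 1#) (<-respʳ-≈ (-‿inverseʳ 1#) (+-monoʳ-< 1# 0<-1))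

  square-nonneg : ∀ x → 0# ≤ x * x
  square-nonneg x x²<0 = <-irrefl refl (<-trans x²<0 (#0⇒square-pos x#0))
    where
    x#0 : x # 0#
    x#0 with #⇒invertible (Equivalence.from #⇔<⊎> (inj₁ x²<0))
    ... | y , y*[x²-0]≈1 , _ = inverseˡ⇒#0 (begin
      y * x * x             ≈⟨ *-assoc y x x ⟩
      y * (x * x)           ≈⟨ *-congˡ (x-0≈x (x * x)) ⟨
      y * (x * x - 0#)      ≈⟨ y*[x²-0]≈1 ⟩
      1#                    ∎)

  nonneg+pos : ∀ {x y} → 0# ≤ x → 0# < y → 0# < x + y
  nonneg+pos {x} {y} 0≤x 0<y with <-cotrans 0<y (x + y)
  ... | inj₁ 0<x+y = 0<x+y
  ... | inj₂ x+y<y = ⊥-elim (0≤x (<-respˡ-≈ x+y-y≈x (<-respʳ-≈ (-‿inverseʳ y) (+-monoˡ-< (- y) x+y<y))))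
    where
    x+y-y≈x : x + y - y ≈ x
    x+y-y≈x = trans (+-assoc x y (- y)) (trans (+-congˡ (-‿inverseʳ y)) (+-identityʳ x))

  fromℕ-pos : ∀ n → 0# < fromℕ (suc n)
  fromℕ-pos zero    = <-respʳ-≈ (sym (+-identityʳ 1#)) 0<1
  fromℕ-pos (suc n) = <-trans (fromℕ-pos n)
    (<-respˡ-≈ (+-identityˡ _) (+-monoˡ-< (fromℕ (suc n)) 0<1))

  recip : (n : ℕ) .{{_ : NonZero n}} → ℝ
  recip (suc n) = proj₁ (inverse (fromℕ (suc n)) (fromℕ-pos n))

  invFact : ℕ → ℝ
  invFact n = recip (n !) {{n ℕ.!≢0}}

module RealAnalysis {c ℓ₁ ℓ₂ ℓ₃} (R : RealNumbers c ℓ₁ ℓ₂ ℓ₃) where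
  open RealNumbers R
  open RealProperties R

  HasSum : (ℕ → ℝ) → ℝ → Set (c ⊔ ℓ₃)
  HasSum a x = ConvergesTo (λ N → sum {N} λ n → a (toℕ n)) x

  -- Functions defined by power series are given by their graphs: IsSin x y says
  -- that the sine series at x converges to y.

  IsSin IsCos : ℝ → ℝ → Set (c ⊔ ℓ₃)
  IsSin x y = HasSum (λ n → (- 1#) ^ n * x ^ suc (2 ℕ.* n) * invFact (suc (2 ℕ.* n))) y
  IsCos x y = HasSum (λ n → (- 1#) ^ n * x ^ (2 ℕ.* n) * invFact (2 ℕ.* n)) y

  -- π is the least positive zero of sin.
  record IsPi (π : ℝ) : Set (c ⊔ ℓ₃) where
    field
      positive : 0# < π
      sin[π]≈0 : IsSin π 0#
      least    : ∀ x → 0# < x → x < π → ¬ IsSin x 0#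

module ComplexAnalysis {c ℓ₁ ℓ₂ ℓ₃} (R : RealNumbers c ℓ₁ ℓ₂ ℓ₃) where
  open RealNumbers R
  open RealProperties R

  infix  4 _≈ᶜ_
  infixl 6 _+ᶜ_ _-ᶜ_
  infixl 7 _*ᶜ_
  infix  8 -ᶜ_

  record ℂ : Set c where
    constructor _+i_
    field
      re im : ℝ
  open ℂ public

  record _≈ᶜ_ (z w : ℂ) : Set ℓ₁ where
    constructor _,_
    field
      re-≈ : re z ≈ re w
      im-≈ : im z ≈ im w
  open _≈ᶜ_ public

  ℂ-setoid : Setoid c ℓ₁
  ℂ-setoid = record
    { Carrier       = ℂ
    ; _≈_           = _≈ᶜ_
    ; isEquivalence = record
      { refl  = refl , refl
      ; sym   = λ (p , q) → sym p , sym q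
      ; trans = λ (p , q) (p′ , q′) → trans p p′ , trans q q′
      }
    }

  ι : ℝ → ℂ
  ι x = x +i 0#

  0ᶜ 1ᶜ i : ℂ
  0ᶜ = ι 0#
  1ᶜ = ι 1#
  i  = 0# +i 1#

  _+ᶜ_ _*ᶜ_ : ℂ → ℂ → ℂ
  (a +i b) +ᶜ (a′ +i b′) = (a + a′) +i (b + b′)
  (a +i b) *ᶜ (a′ +i b′) = (a * a′ - b * b′) +i (a * b′ + b * a′)

  -ᶜ_ : ℂ → ℂ
  -ᶜ z = (- re z) +i (- im z)

  _-ᶜ_ : ℂ → ℂ → ℂ
  z -ᶜ w = z +ᶜ (-ᶜ w)

  ℂ-rawSemiring : RawSemiring c ℓ₁
  ℂ-rawSemiring = record { _≈_ = _≈ᶜ_ ; _+_ = _+ᶜ_ ; _*_ = _*ᶜ_ ; 0# = 0ᶜ ; 1# = 1ᶜ }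

  open SemiringDefs ℂ-rawSemiring public using ()
    renaming (_^_ to _^ᶜ_; sum to sumᶜ; _×_ to _⋆ᶜ_)

  -- ∣ z ∣²; moduli are compared through their squares.
  normSq : ℂ → ℝ
  normSq (a +i b) = a * a + b * b

  ConvergesToᶜ : (ℕ → ℂ) → ℂ → Set (c ⊔ ℓ₃)
  ConvergesToᶜ s z = ∀ ε → 0# < ε →
    ∃[ N ] (∀ n → N ℕ.≤ n → normSq (s n -ᶜ z) < ε * ε)

  HasSumᶜ : (ℕ → ℂ) → ℂ → Set (c ⊔ ℓ₃)
  HasSumᶜ a z = ConvergesToᶜ (λ N → sumᶜ {N} λ n → a (toℕ n)) z

  IsExp : ℂ → ℂ → Set (c ⊔ ℓ₃)
  IsExp z w = HasSumᶜ (λ n → z ^ᶜ n *ᶜ ι (invFact n)) w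

  module _ {p} (D : Pred ℂ p) where

    Region : Setoid (c ⊔ p) ℓ₁
    Region = record
      { Carrier       = Σ ℂ D
      ; _≈_           = λ z w → proj₁ z ≈ᶜ proj₁ w
      ; isEquivalence = record
        { refl  = ℂₛ.refl
        ; sym   = ℂₛ.sym
        ; trans = ℂₛ.trans
        }
      }
      where module ℂₛ = Setoid ℂ-setoid

    HasDerivativeAt : Func Region ℂ-setoid → Σ ℂ D → ℂ → Set (c ⊔ ℓ₃ ⊔ p)
    HasDerivativeAt f z d = ∀ ε → 0# < ε → ∃[ δ ] 0# < δ × (∀ w →
      let h = proj₁ w -ᶜ proj₁ z in
      normSq h < δ * δ →
      normSq (Func.to f w -ᶜ Func.to f z -ᶜ d *ᶜ h) ≤ ε * ε * normSq h)

    Holomorphic : Func Region ℂ-setoid → Set (c ⊔ ℓ₃ ⊔ p)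
    Holomorphic f = ∀ z → ∃[ d ] HasDerivativeAt f z d

  InUpperHalfPlane InUnitDisc : Pred ℂ ℓ₃
  InUpperHalfPlane z = 0# < im z
  InUnitDisc q       = normSq q < 1#

  ℍ 𝔻 : Set (c ⊔ ℓ₃)
  ℍ = Σ ℂ InUpperHalfPlane
  𝔻 = Σ ℂ InUnitDisc

  ℍ→ℂ 𝔻→ℂ : Set (c ⊔ ℓ₁ ⊔ ℓ₃)
  ℍ→ℂ = Func (Region InUpperHalfPlane) ℂ-setoid
  𝔻→ℂ = Func (Region InUnitDisc) ℂ-setoid

  infixl 9 _⟨_⟩
  _⟨_⟩ : ℍ→ℂ → ℍ → ℂ
  f ⟨ z ⟩ = Func.to f z

  -- lim f(z) = L as z → i∞, i.e. as Im z → ∞ uniformly in Re z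
  LimitAti∞ : ℍ→ℂ → ℂ → Set (c ⊔ ℓ₃)
  LimitAti∞ f L = ∀ ε → 0# < ε →
    ∃[ Y ] (∀ z → Y < im (proj₁ z) → normSq (f ⟨ z ⟩ -ᶜ L) < ε * ε)

  translate : ℝ → ℍ → ℍ
  translate t (z , 0<y) = z +ᶜ ι t , <-respʳ-≈ (sym (+-identityʳ (im z))) 0<y

  -- z ↦ -1/z, computed as (- x + i y) / (x² + y²)
  S : ℍ → ℍ
  S (x +i y , 0<y) = (- x * u) +i (y * u) , *-pos 0<y (inverse-pos 0<∣z∣² u∣z∣²≈1)
    where
    0<∣z∣² : 0# < x * x + y * y
    0<∣z∣² = nonneg+pos (square-nonneg x) (*-pos 0<y 0<y)
    u : ℝ
    u = proj₁ (inverse (x * x + y * y) 0<∣z∣²)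
    u∣z∣²≈1 : u * (x * x + y * y) ≈ 1#
    u∣z∣²≈1 = proj₂ (inverse (x * x + y * y) 0<∣z∣²)

module Matrices {c ℓ₁ ℓ₂ ℓ₃} (R : RealNumbers c ℓ₁ ℓ₂ ℓ₃) where
  open RealProperties R
  open ComplexAnalysis R

  Matrix : ℕ → Set c
  Matrix n = Fin n → Fin n → ℂ

  identity : ∀ {n} → Matrix n
  identity j k = if ⌊ toℕ j ℕ.≟ toℕ k ⌋ then 1ᶜ else 0ᶜ

  _⊗_ : ∀ {n} → Matrix n → Matrix n → Matrix n
  (M ⊗ N) j k = sumᶜ λ l → M j l *ᶜ N l k

  power : ∀ {n} → Matrix n → ℕ → Matrix n
  power M zero    = identity
  power M (suc m) = M ⊗ power M m

  scale : ∀ {n} → ℂ → Matrix n → Matrix n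
  scale a M j k = a *ᶜ M j k

  apply : ∀ {n} → Matrix n → Vector ℂ n → Vector ℂ n
  apply M v j = sumᶜ λ k → M j k *ᶜ v k

  -- The series Σ Mⁿ / n! converges entrywise to X; limits being unique, this
  -- determines X as e^M.
  IsMatrixExp : ∀ {n} → Matrix n → Matrix n → Set _
  IsMatrixExp M X = ∀ j k → HasSumᶜ (λ n → power M n j k *ᶜ ι (invFact n)) (X j k)

  creation : ∀ r → Matrix (suc r)
  creation r j k = if ⌊ toℕ j ℕ.≟ suc (toℕ k) ⌋ then toℕ j ⋆ᶜ 1ᶜ else 0ᶜ

-- ϖ = 2 cos (π / μ)
IsHeckeWidth : ∀ {c ℓ₁ ℓ₂ ℓ₃} (R : RealNumbers c ℓ₁ ℓ₂ ℓ₃) →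
  let open RealNumbers R in (μ : ℕ) .{{_ : NonZero μ}} → (π ϖ : ℝ) → Set (c ⊔ ℓ₁ ⊔ ℓ₃)
IsHeckeWidth R μ π ϖ = ∃[ x ] IsCos (π * recip μ) x × ϖ ≈ fromℕ 2 * x
  where open RealNumbers R; open RealProperties R; open RealAnalysis R

module HeckeTriangle {c ℓ₁ ℓ₂ ℓ₃} (R : RealNumbers c ℓ₁ ℓ₂ ℓ₃)
  (π ϖ : RealNumbers.ℝ R) where
  open RealNumbers R
  open RealProperties R
  open ComplexAnalysis R
  open Matrices R

  T : ℍ → ℍ
  T = translate ϖ

  -- H is a holomorphic function of the local parameter q = exp (2πiz / ϖ),
  -- including at q = 0.
  HolomorphicAtCusp : ℍ→ℂ → Set _
  HolomorphicAtCusp H = Σ[ h ∈ 𝔻→ℂ ] Holomorphic InUnitDisc h × (∀ (z : ℍ) w (q : 𝔻) →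
    ι ϖ *ᶜ w ≈ᶜ ι (fromℕ 2 * π) *ᶜ i *ᶜ proj₁ z → IsExp w (proj₁ q) →
    H ⟨ z ⟩ ≈ᶜ Func.to h q)

  record AutomorphicForm (k : ℕ) : Set (c ⊔ ℓ₁ ⊔ ℓ₃) where
    field
      function          : ℍ→ℂ
      holomorphic       : Holomorphic InUpperHalfPlane function
      holomorphicAtCusp : HolomorphicAtCusp function
      T-invariant       : ∀ z → function ⟨ T z ⟩ ≈ᶜ function ⟨ z ⟩
      S-automorphic     : ∀ z → function ⟨ S z ⟩ ≈ᶜ proj₁ z ^ᶜ k *ᶜ function ⟨ z ⟩

  -- The weight 2 quasiautomorphic Eisenstein series.  There are no nonzero
  -- automorphic forms of weight 2, so these conditions determine E₂ once the
  -- normalisation lim E₂ = C is chosen; the anomaly κ is a nonzero constant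
  -- depending on that normalisation.
  record EisensteinSeries₂ : Set (c ⊔ ℓ₁ ⊔ ℓ₃) where
    field
      E₂          : ℍ→ℂ
      C           : ℂ
      κ           : ℂ
      holomorphic : Holomorphic InUpperHalfPlane E₂
      T-periodic  : ∀ z → E₂ ⟨ T z ⟩ ≈ᶜ E₂ ⟨ z ⟩
      S-quasi     : ∀ z → E₂ ⟨ S z ⟩ ≈ᶜ proj₁ z ^ᶜ 2 *ᶜ E₂ ⟨ z ⟩ +ᶜ κ *ᶜ proj₁ z
      κ≉0         : 0# < normSq κ
      limit       : LimitAti∞ E₂ C

  module _ (𝓔 : EisensteinSeries₂) where
    open EisensteinSeries₂ 𝓔 using (E₂; C)

    -- U together with its decomposition; B k is the coefficient of E₂ᵏ.
    record QuasiautomorphicForm (w r : ℕ) : Set (c ⊔ ℓ₁ ⊔ ℓ₃) where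
      field
        U    : ℍ→ℂ
        form : (k : Fin (suc r)) → AutomorphicForm (w ∸ 2 ℕ.* toℕ k)

      B : Fin (suc r) → ℍ→ℂ
      B k = AutomorphicForm.function (form k)

      field
        decomposition : ∀ z → U ⟨ z ⟩ ≈ᶜ sumᶜ λ k → B k ⟨ z ⟩ *ᶜ E₂ ⟨ z ⟩ ^ᶜ toℕ k

    -- {r,ℓ}ₘ
    coefficient : (r ℓ m : ℕ) → ℝ
    coefficient r ℓ m =
      fromℕ ((m ℕ.+ ℓ) ! ℕ.* (r ∸ ℓ) !) * recip (m ! ℕ.* r !) {{m ℕ.!* r !≢0}}

    -- ℓ + m ≤ r for m ≤ r - ℓ
    shift : ∀ {r} (ℓ : Fin (suc r)) → Fin (suc (r ∸ toℕ ℓ)) → Fin (suc r)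
    shift {r} ℓ m = fromℕ< {toℕ ℓ ℕ.+ toℕ m} (ℕ.s≤s
      (≡.subst (toℕ ℓ ℕ.+ toℕ m ℕ.≤_) (ℕ.m+[n∸m]≡n (toℕ≤pred[n] ℓ))
        (ℕ.+-monoʳ-≤ (toℕ ℓ) (toℕ≤pred[n] m))))

    module _ {w r : ℕ} (𝓤 : QuasiautomorphicForm w r) where
      open QuasiautomorphicForm 𝓤 using (B)

      g : Fin (suc r) → ℍ → ℂ
      g ℓ z = C ^ᶜ toℕ ℓ *ᶜ sumᶜ λ (m : Fin (suc (r ∸ toℕ ℓ))) →
        ι (coefficient r (toℕ ℓ) (toℕ m)) *ᶜ B (shift ℓ m) ⟨ z ⟩ *ᶜ E₂ ⟨ z ⟩ ^ᶜ toℕ m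

      f : Fin (suc r) → ℍ → ℂ
      f n z = sumᶜ λ (k : Fin (suc (toℕ n))) →
        ((toℕ n choose toℕ k) ⋆ᶜ 1ᶜ) *ᶜ g (inject≤ k (toℕ<n n)) z *ᶜ proj₁ z ^ᶜ (toℕ n ∸ toℕ k)

      heckeVectorForm : ℍ → Vector ℂ (suc r)
      heckeVectorForm z n = f n z

-- The coefficients g_ℓ are T-invariant, and f_n = Σ_k C(n,k) g_k z^(n-k) is the value at 0 of
-- (σ + z)ⁿ g, where σ is the shift of sequences.  Likewise e^(ϖA) has entries C(n,k) ϖ^(n-k) and
-- sends a sequence h to the sequence of values at 0 of (σ + ϖ)ⁿ h.  On f this gives the values at 0
-- of (σ + z + ϖ)ⁿ g, since shifting f amounts to applying σ + z to g.
-- A is nilpotent, so the partial sums of the exponential series are eventually constant.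

module Submission where

open import Defs
open import Algebra.Bundles using (CommutativeRing; CommutativeSemiring)
open import Algebra.Structures.Biased using (isCommutativeSemiringˡ)
open import Data.Bool.Base using (if_then_else_)
open import Data.Fin.Base using (Fin; zero; suc; toℕ; fromℕ<; inject≤; inject₁; punchIn)
import Data.Fin.Properties as Fin
open import Data.Nat using (ℕ; zero; suc; _+_; _≤_; _<_; _*_; _∸_; _!; _≟_; _<?_; _≤?_; s≤s; NonZero)
open import Data.Nat.Combinatorics
  using (nCk+nC[k+1]≡[n+1]C[k+1]; nCk≡n!/k![n-k]!; nCn≡1; k>n⇒nCk≡0; k![n∸k]!∣n!)
  renaming (_C_ to infixl 9 _choose_)
open import Data.Nat.Divisibility using (_∣_)
open import Data.Nat.DivMod using (m/n*n≡m)
import Data.Nat.Properties as ℕ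
open import Data.Product using (Σ-syntax; _×_; _,_; proj₁; proj₂)
open import Data.Vec.Functional using (Vector)
open import Function.Base using (_∘_)
open import Relation.Binary.Bundles using (Setoid)
open import Relation.Binary.PropositionalEquality as ≡ using (_≡_; _≢_)
open import Relation.Nullary.Decidable using (Dec; yes; no; ⌊_⌋)
open import Relation.Nullary.Negation using (¬_; contradiction)
import Algebra.Definitions
import Algebra.Properties.CommutativeSemigroup as CommutativeSemigroupProperties
import Algebra.Properties.Ring as RingProperties
import Algebra.Properties.Semiring.Exp as Exp
import Algebra.Properties.Semiring.Mult as Mult
import Algebra.Properties.Semiring.Sum as Sum
import Algebra.Solver.Ring.NaturalCoefficients.Default as SemiringSolver
import Relation.Binary.Reasoning.Setoid as SetoidReasoning

-- Deciding matrix entries, and finite vectors as sequences.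

if-yes : ∀ {a p} {A : Set a} {P : Set p} {x y : A} (P? : Dec P) → P →
  (if ⌊ P? ⌋ then x else y) ≡ x
if-yes (yes _) _ = ≡.refl
if-yes (no ¬p) p = contradiction p ¬p

if-no : ∀ {a p} {A : Set a} {P : Set p} {x y : A} (P? : Dec P) → ¬ P →
  (if ⌊ P? ⌋ then x else y) ≡ y
if-no (yes p) ¬p = contradiction p ¬p
if-no (no _)  _  = ≡.refl

-- Padding with a default makes a vector a sequence on all of `ℕ`, where the shift `_∘ suc` needs no
-- change of index type.
extend : ∀ {a} {A : Set a} {n} → A → Vector A n → ℕ → A
extend {n = zero}  d v k       = d
extend {n = suc n} d v zero    = v zero
extend {n = suc n} d v (suc k) = extend d (v ∘ suc) k

extend-toℕ : ∀ {a} {A : Set a} {n} (d : A) (v : Vector A n) i → extend d v (toℕ i) ≡ v i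
extend-toℕ d v zero    = ≡.refl
extend-toℕ d v (suc i) = extend-toℕ d (v ∘ suc) i

-- Factorial identities for binomial coefficients.

-- The binomial coefficient is a quotient of factorials, exact because `k ! * m !` divides
-- `(m + k) !`. Writing the upper index as `m + k` keeps truncated subtraction out of later
-- inductions.
choose-*-! : ∀ m k → (m + k) choose k * m ! * k ! ≡ (m + k) !
choose-*-! m k = begin
  (m + k) choose k * m ! * k !                      ≡⟨ ℕ.*-assoc ((m + k) choose k) (m !) (k !) ⟩
  (m + k) choose k * (m ! * k !)                    ≡⟨ ≡.cong ((m + k) choose k *_) (ℕ.*-comm (m !) (k !)) ⟩
  (m + k) choose k * (k ! * m !)                    ≡⟨ ≡.cong (λ l → (m + k) choose k * (k ! * l !)) (ℕ.m+n∸n≡m m k) ⟨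
  (m + k) choose k * (k ! * (m + k ∸ k) !)          ≡⟨ ≡.cong (_* (k ! * (m + k ∸ k) !)) (nCk≡n!/k![n-k]! (ℕ.m≤n+m k m)) ⟩
  _                                                 ≡⟨ m/n*n≡m {{k ℕ.!* (m + k ∸ k) !≢0}} (k![n∸k]!∣n! (ℕ.m≤n+m k m)) ⟩
  (m + k) !                                         ∎
  where open ≡.≡-Reasoning

-- After multiplication by `k !` both sides equal `suc (m + k) !`. This is the recursion from one
-- matrix power to the next along a column.
choose-*-!-suc : ∀ m k →
  suc (m + k) * ((m + k) choose k * m !) ≡ suc (m + k) choose k * suc m !
choose-*-!-suc m k = ℕ.*-cancelʳ-≡ _ _ (k !) {{k ℕ.!≢0}} (begin
  suc (m + k) * ((m + k) choose k * m !) * k !   ≡⟨ ℕ.*-assoc (suc (m + k)) ((m + k) choose k * m !) (k !) ⟩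
  suc (m + k) * ((m + k) choose k * m ! * k !)   ≡⟨ ≡.cong (suc (m + k) *_) (choose-*-! m k) ⟩
  suc (m + k) * (m + k) !                        ≡⟨ choose-*-! (suc m) k ⟨
  suc (m + k) choose k * suc m ! * k !           ∎)
  where open ≡.≡-Reasoning

-- Binomial transforms of sequences over a commutative semiring.

module Appell {c ℓ} (𝕊 : CommutativeSemiring c ℓ) where
  open CommutativeSemiring 𝕊 hiding (zero) renaming (_+_ to _⊕_; _*_ to _⊛_)
  open Exp semiring using (_^_)
  open Mult semiring using (×-homo-+) renaming (_×_ to _⋆_)
  open Sum semiring using (sum; sum-cong-≋; sum-remove; sum-replicate-zero; ∑-distrib-+; *-distribˡ-sum)
  open CommutativeSemigroupProperties (CommutativeSemiring.*-commutativeSemigroup 𝕊) using ()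
    renaming (x∙yz≈y∙xz to x*yz≈y*xz)
  open CommutativeSemigroupProperties (CommutativeSemiring.+-commutativeSemigroup 𝕊) using ()
    renaming (interchange to +-interchange; x∙yz≈y∙xz to x+yz≈y+xz)
  open SetoidReasoning setoid

  sum-zero : ∀ {n} (v : Vector Carrier n) → (∀ k → v k ≈ 0#) → sum v ≈ 0#
  sum-zero {n} v v≈0 = trans (sum-cong-≋ v≈0) (sum-replicate-zero n)

  sum-single : ∀ {n} (v : Vector Carrier n) i → (∀ k → k ≢ i → v k ≈ 0#) → sum v ≈ v i
  sum-single {suc n} v i v≈0 = begin
    sum v                          ≈⟨ sum-remove {i = i} v ⟩
    v i ⊕ sum (v ∘ punchIn i)      ≈⟨ +-congˡ (sum-zero (v ∘ punchIn i) λ k → v≈0 _ (Fin.punchInᵢ≢i i k)) ⟩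
    v i ⊕ 0#                       ≈⟨ +-identityʳ (v i) ⟩
    v i                            ∎

  -- The value at 0 of (shift + x)ⁿ h; in umbral notation, (h + x)ⁿ.
  appell : Carrier → (ℕ → Carrier) → ℕ → Carrier
  appell x h zero    = h zero
  appell x h (suc n) = appell x (h ∘ suc) n ⊕ x ⊛ appell x h n

  appell-cong : ∀ {x y h h′} → x ≈ y → (∀ k → h k ≈ h′ k) → ∀ n → appell x h n ≈ appell y h′ n
  appell-cong x≈y h≈h′ zero    = h≈h′ zero
  appell-cong x≈y h≈h′ (suc n) =
    +-cong (appell-cong x≈y (h≈h′ ∘ suc) n) (*-cong x≈y (appell-cong x≈y h≈h′ n))

  -- This and `appell-homo-*` give linearity in the sequence, used in `appell-∘`, where shifting the
  -- inner sequence produces a sum.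
  appell-distrib-+ : ∀ x h h′ n → appell x (λ k → h k ⊕ h′ k) n ≈ appell x h n ⊕ appell x h′ n
  appell-distrib-+ x h h′ zero    = refl
  appell-distrib-+ x h h′ (suc n) = begin
    _
      ≈⟨ +-cong (appell-distrib-+ x (h ∘ suc) (h′ ∘ suc) n) (*-congˡ (appell-distrib-+ x h h′ n)) ⟩
    (appell x (h ∘ suc) n ⊕ appell x (h′ ∘ suc) n) ⊕ x ⊛ (appell x h n ⊕ appell x h′ n)
      ≈⟨ +-congˡ (distribˡ x _ _) ⟩
    (appell x (h ∘ suc) n ⊕ appell x (h′ ∘ suc) n) ⊕ (x ⊛ appell x h n ⊕ x ⊛ appell x h′ n)
      ≈⟨ +-interchange _ _ _ _ ⟩
    appell x h (suc n) ⊕ appell x h′ (suc n) ∎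

  appell-homo-* : ∀ x y h n → appell x (λ k → y ⊛ h k) n ≈ y ⊛ appell x h n
  appell-homo-* x y h zero    = refl
  appell-homo-* x y h (suc n) = begin
    _
      ≈⟨ +-cong (appell-homo-* x y (h ∘ suc) n) (*-congˡ (appell-homo-* x y h n)) ⟩
    y ⊛ appell x (h ∘ suc) n ⊕ x ⊛ (y ⊛ appell x h n)   ≈⟨ +-congˡ (x*yz≈y*xz x y _) ⟩
    y ⊛ appell x (h ∘ suc) n ⊕ y ⊛ (x ⊛ appell x h n)   ≈⟨ distribˡ y _ _ ⟨
    y ⊛ appell x h (suc n)                              ∎

  -- Shifting the sequence `appell y h` amounts to applying shift + `y` to `h`, so shift + `x`
  -- outside becomes shift + `y` + `x` on `h`. Linearity carries this through the induction.
  appell-∘ : ∀ x y h n → appell x (appell y h) n ≈ appell (y ⊕ x) h n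
  appell-∘ x y h zero    = refl
  appell-∘ x y h (suc n) = begin
    appell x (λ k → appell y (h ∘ suc) k ⊕ y ⊛ appell y h k) n ⊕ x ⊛ appell x (appell y h) n
      ≈⟨ +-congʳ (appell-distrib-+ x _ _ n) ⟩
    (appell x (appell y (h ∘ suc)) n ⊕ appell x (λ k → y ⊛ appell y h k) n) ⊕ x ⊛ appell x (appell y h) n
      ≈⟨ +-congʳ (+-congˡ (appell-homo-* x y _ n)) ⟩
    (appell x (appell y (h ∘ suc)) n ⊕ y ⊛ appell x (appell y h) n) ⊕ x ⊛ appell x (appell y h) n
      ≈⟨ +-assoc _ _ _ ⟩
    appell x (appell y (h ∘ suc)) n ⊕ (y ⊛ appell x (appell y h) n ⊕ x ⊛ appell x (appell y h) n)
      ≈⟨ +-congˡ (distribʳ _ y x) ⟨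
    appell x (appell y (h ∘ suc)) n ⊕ (y ⊕ x) ⊛ appell x (appell y h) n
      ≈⟨ +-cong (appell-∘ x y (h ∘ suc) n) (*-congˡ (appell-∘ x y h n)) ⟩
    appell (y ⊕ x) h (suc n) ∎

  appellTerm : Carrier → (ℕ → Carrier) → ℕ → ℕ → Carrier
  appellTerm x h n k = (n choose k ⋆ 1#) ⊛ h k ⊛ x ^ (n ∸ k)

  -- For `k < n` the power sheds one factor `x`. For `k ≥ n` the truncated exponents no longer
  -- differ by one, but the binomial coefficient is zero and both sides vanish.
  choose-suc-pow : ∀ x y n k →
    (n choose suc k ⋆ 1#) ⊛ y ⊛ x ^ (n ∸ k) ≈ x ⊛ ((n choose suc k ⋆ 1#) ⊛ y ⊛ x ^ (n ∸ suc k))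
  choose-suc-pow x y n k with k <? n
  ... | yes k<n rewrite ℕ.+-∸-assoc 1 k<n = x*yz≈y*xz _ x _
  ... | no  k≮n rewrite k>n⇒nCk≡0 (s≤s (ℕ.≮⇒≥ k≮n)) =
    trans (vanish _) (sym (trans (*-congˡ (vanish _)) (zeroʳ x)))
    where
    vanish : ∀ z → 0# ⊛ y ⊛ z ≈ 0#
    vanish z = trans (*-congʳ (zeroˡ y)) (zeroˡ z)

  -- Pascal's rule splits the term into the two contributions that the recursion of `appell`
  -- prescribes.
  appellTerm-suc : ∀ x h n k →
    appellTerm x h (suc n) (suc k) ≈ appellTerm x (h ∘ suc) n k ⊕ x ⊛ appellTerm x h n (suc k)
  appellTerm-suc x h n k = begin
    (suc n choose suc k ⋆ 1#) ⊛ h (suc k) ⊛ p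
      ≡⟨ ≡.cong (λ b → (b ⋆ 1#) ⊛ h (suc k) ⊛ p) (nCk+nC[k+1]≡[n+1]C[k+1] n k) ⟨
    ((n choose k + n choose suc k) ⋆ 1#) ⊛ h (suc k) ⊛ p
      ≈⟨ *-congʳ (*-congʳ (×-homo-+ 1# (n choose k) (n choose suc k))) ⟩
    ((n choose k ⋆ 1#) ⊕ (n choose suc k ⋆ 1#)) ⊛ h (suc k) ⊛ p
      ≈⟨ trans (*-congʳ (distribʳ _ _ _)) (distribʳ _ _ _) ⟩
    appellTerm x (h ∘ suc) n k ⊕ (n choose suc k ⋆ 1#) ⊛ h (suc k) ⊛ p
      ≈⟨ +-congˡ (choose-suc-pow x (h (suc k)) n k) ⟩
    appellTerm x (h ∘ suc) n k ⊕ x ⊛ appellTerm x h n (suc k) ∎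
    where p = x ^ (n ∸ k)

  -- Any length `N` above `n` is allowed, since the binomial coefficient kills every term with index
  -- beyond `n`. This freedom lets full matrix rows of length `suc r` and the shorter sums defining
  -- `f` be treated alike.
  appell-expand : ∀ x h {n N} → n < N → appell x h n ≈ sum {N} (appellTerm x h n ∘ toℕ)
  appell-expand x h {zero} {suc N} _ = sym (begin
    sum {suc N} (appellTerm x h 0 ∘ toℕ)
      ≈⟨ sum-single {suc N} (appellTerm x h 0 ∘ toℕ) zero (λ { zero 0≢0 → contradiction ≡.refl 0≢0
                                      ; (suc k) _ → trans (*-congʳ (zeroˡ _)) (zeroˡ _) }) ⟩
    (1# ⊕ 0#) ⊛ h 0 ⊛ 1#   ≈⟨ *-identityʳ _ ⟩
    (1# ⊕ 0#) ⊛ h 0        ≈⟨ *-congʳ (+-identityʳ 1#) ⟩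
    1# ⊛ h 0               ≈⟨ *-identityˡ _ ⟩
    h 0                    ∎)
  appell-expand x h {suc n} {suc N} (s≤s n<N) = begin
    appell x (h ∘ suc) n ⊕ x ⊛ appell x h n
      -- The second sum is expanded to one more term than the first, so that splitting off its term
      -- at `0` leaves two sums of equal length.
      ≈⟨ +-cong (appell-expand x (h ∘ suc) n<N) (*-congˡ (appell-expand x h (ℕ.m<n⇒m<1+n n<N))) ⟩
    sum a ⊕ x ⊛ (appellTerm x h n 0 ⊕ sum b)
      ≈⟨ +-congˡ (distribˡ x _ _) ⟩
    sum a ⊕ (x ⊛ appellTerm x h n 0 ⊕ x ⊛ sum b)
      ≈⟨ x+yz≈y+xz _ _ _ ⟩
    x ⊛ appellTerm x h n 0 ⊕ (sum a ⊕ x ⊛ sum b)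
      ≈⟨ +-cong (x*yz≈y*xz x _ _) (+-congˡ (*-distribˡ-sum x b)) ⟩
    appellTerm x h (suc n) 0 ⊕ (sum a ⊕ sum (λ k → x ⊛ b k))
      ≈⟨ +-congˡ (∑-distrib-+ a _) ⟨
    appellTerm x h (suc n) 0 ⊕ sum (λ k → a k ⊕ x ⊛ b k)
      ≈⟨ +-congˡ (sum-cong-≋ {N} (λ k → appellTerm-suc x h n (toℕ k))) ⟨
    sum {suc N} (appellTerm x h (suc n) ∘ toℕ) ∎
    where
    a b : Vector Carrier N
    a = appellTerm x (h ∘ suc) n ∘ toℕ
    b = appellTerm x h n ∘ suc ∘ toℕ

-- The complex numbers as a commutative semiring.

module ComplexProperties {c ℓ₁ ℓ₂ ℓ₃} (R : RealNumbers c ℓ₁ ℓ₂ ℓ₃) where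
  open RealNumbers R renaming (_+_ to _⊕_; _*_ to _⊛_) hiding (_≤_; _<_)
  open RealProperties R
  open ComplexAnalysis R hiding (i)
  open SemiringSolver (CommutativeRing.commutativeSemiring commutativeRing) using (solve; _:+_; _:*_; _:=_)
  open RingProperties ring using (-0#≈0#; -1*x≈-x)
  open SetoidReasoning setoid

  x-0*y≈x : ∀ x y → x - 0# ⊛ y ≈ x
  x-0*y≈x x y = begin
    x - 0# ⊛ y  ≈⟨ +-congˡ (-‿cong (zeroˡ y)) ⟩
    x - 0#      ≈⟨ +-congˡ -0#≈0# ⟩
    x ⊕ 0#      ≈⟨ +-identityʳ x ⟩
    x           ∎

  -- Turns identities with subtraction into semiring identities in the additional variable - 1#.
  -‿scales : ∀ x → - x ≈ - 1# ⊛ x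
  -‿scales x = sym (-1*x≈-x x)

  ℂ-commutativeSemiring : CommutativeSemiring c ℓ₁
  ℂ-commutativeSemiring = record
    { Carrier = ℂ
    ; _≈_ = _≈ᶜ_
    ; _+_ = _+ᶜ_
    ; _*_ = _*ᶜ_
    ; 0#  = 0ᶜ
    ; 1#  = 1ᶜ
    ; isCommutativeSemiring = isCommutativeSemiringˡ (record
      { +-isCommutativeMonoid = record
        { isMonoid = record
          { isSemigroup = record
            { isMagma = record
              { isEquivalence = isEquivalenceᶜ
              ; ∙-cong = λ (p , q) (p′ , q′) → +-cong p p′ , +-cong q q′
              }
            ; assoc = λ _ _ _ → +-assoc _ _ _ , +-assoc _ _ _
            }
          ; identity = (λ _ → +-identityˡ _ , +-identityˡ _) , (λ _ → +-identityʳ _ , +-identityʳ _)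
          }
        ; comm = λ _ _ → +-comm _ _ , +-comm _ _
        }
      ; *-isCommutativeMonoid = record
        { isMonoid = record
          { isSemigroup = record
            { isMagma = record
              { isEquivalence = isEquivalenceᶜ
              ; ∙-cong = λ (p , q) (p′ , q′) →
                  +-cong (*-cong p p′) (-‿cong (*-cong q q′)) ,
                  +-cong (*-cong p q′) (*-cong q p′)
              }
            ; assoc = *ᶜ-assoc
            }
          ; identity = *ᶜ-identityˡ , λ z → transᶜ (*ᶜ-comm z 1ᶜ) (*ᶜ-identityˡ z)
          }
        ; comm = *ᶜ-comm
        }
      ; distribʳ = *ᶜ-distribʳ
      ; zeroˡ = λ (a +i b) → trans (x-0*y≈x _ b) (zeroˡ a) , trans (+-cong (zeroˡ b) (zeroˡ a)) (+-identityˡ 0#)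
      })
    }
    where
    open Setoid ℂ-setoid using () renaming (isEquivalence to isEquivalenceᶜ; trans to transᶜ)
    open Algebra.Definitions _≈ᶜ_

    *ᶜ-assoc : Associative _*ᶜ_
    *ᶜ-assoc (a +i b) (a′ +i b′) (a″ +i b″) =
      (begin
        (a ⊛ a′ - b ⊛ b′) ⊛ a″ - (a ⊛ b′ ⊕ b ⊛ a′) ⊛ b″
          ≈⟨ +-cong (*-congʳ (+-congˡ (-‿scales _))) (-‿scales _) ⟩
        (a ⊛ a′ ⊕ - 1# ⊛ (b ⊛ b′)) ⊛ a″ ⊕ - 1# ⊛ ((a ⊛ b′ ⊕ b ⊛ a′) ⊛ b″)
          ≈⟨ solve 7 (λ ν a b a′ b′ a″ b″ →
               (a :* a′ :+ ν :* (b :* b′)) :* a″ :+ ν :* ((a :* b′ :+ b :* a′) :* b″) :=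
               a :* (a′ :* a″ :+ ν :* (b′ :* b″)) :+ ν :* (b :* (a′ :* b″ :+ b′ :* a″)))
               refl (- 1#) a b a′ b′ a″ b″ ⟩
        a ⊛ (a′ ⊛ a″ ⊕ - 1# ⊛ (b′ ⊛ b″)) ⊕ - 1# ⊛ (b ⊛ (a′ ⊛ b″ ⊕ b′ ⊛ a″))
          ≈⟨ +-cong (*-congˡ (+-congˡ (-‿scales _))) (-‿scales _) ⟨
        a ⊛ (a′ ⊛ a″ - b′ ⊛ b″) - b ⊛ (a′ ⊛ b″ ⊕ b′ ⊛ a″) ∎) ,
      (begin
        (a ⊛ a′ - b ⊛ b′) ⊛ b″ ⊕ (a ⊛ b′ ⊕ b ⊛ a′) ⊛ a″
          ≈⟨ +-congʳ (*-congʳ (+-congˡ (-‿scales _))) ⟩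
        (a ⊛ a′ ⊕ - 1# ⊛ (b ⊛ b′)) ⊛ b″ ⊕ (a ⊛ b′ ⊕ b ⊛ a′) ⊛ a″
          ≈⟨ solve 7 (λ ν a b a′ b′ a″ b″ →
               (a :* a′ :+ ν :* (b :* b′)) :* b″ :+ (a :* b′ :+ b :* a′) :* a″ :=
               a :* (a′ :* b″ :+ b′ :* a″) :+ b :* (a′ :* a″ :+ ν :* (b′ :* b″)))
               refl (- 1#) a b a′ b′ a″ b″ ⟩
        a ⊛ (a′ ⊛ b″ ⊕ b′ ⊛ a″) ⊕ b ⊛ (a′ ⊛ a″ ⊕ - 1# ⊛ (b′ ⊛ b″))
          ≈⟨ +-congˡ (*-congˡ (+-congˡ (-‿scales _))) ⟨
        a ⊛ (a′ ⊛ b″ ⊕ b′ ⊛ a″) ⊕ b ⊛ (a′ ⊛ a″ - b′ ⊛ b″) ∎)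

    *ᶜ-comm : Commutative _*ᶜ_
    *ᶜ-comm (a +i b) (a′ +i b′) =
      +-cong (*-comm a a′) (-‿cong (*-comm b b′)) ,
      trans (+-comm _ _) (+-cong (*-comm b a′) (*-comm a b′))

    *ᶜ-identityˡ : LeftIdentity 1ᶜ _*ᶜ_
    *ᶜ-identityˡ (a +i b) =
      trans (x-0*y≈x _ b) (*-identityˡ a) ,
      trans (+-cong (*-identityˡ b) (zeroˡ a)) (+-identityʳ b)

    *ᶜ-distribʳ : _*ᶜ_ DistributesOverʳ _+ᶜ_
    *ᶜ-distribʳ (a +i b) (a′ +i b′) (a″ +i b″) =
      (begin
        (a′ ⊕ a″) ⊛ a - (b′ ⊕ b″) ⊛ b
          ≈⟨ +-congˡ (-‿scales _) ⟩
        (a′ ⊕ a″) ⊛ a ⊕ - 1# ⊛ ((b′ ⊕ b″) ⊛ b)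
          ≈⟨ solve 7 (λ ν a b a′ b′ a″ b″ →
               (a′ :+ a″) :* a :+ ν :* ((b′ :+ b″) :* b) :=
               (a′ :* a :+ ν :* (b′ :* b)) :+ (a″ :* a :+ ν :* (b″ :* b)))
               refl (- 1#) a b a′ b′ a″ b″ ⟩
        (a′ ⊛ a ⊕ - 1# ⊛ (b′ ⊛ b)) ⊕ (a″ ⊛ a ⊕ - 1# ⊛ (b″ ⊛ b))
          ≈⟨ +-cong (+-congˡ (-‿scales _)) (+-congˡ (-‿scales _)) ⟨
        (a′ ⊛ a - b′ ⊛ b) ⊕ (a″ ⊛ a - b″ ⊛ b) ∎) ,
      solve 6 (λ a b a′ b′ a″ b″ →
        (a′ :+ a″) :* b :+ (b′ :+ b″) :* a :=
        (a′ :* b :+ b′ :* a) :+ (a″ :* b :+ b″ :* a)) refl a b a′ b′ a″ b″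

  module ℂₛ = CommutativeSemiring ℂ-commutativeSemiring

  -- Real scalars, inverse factorials and convergence in the complex numbers.

  ⋆1≈ι : ∀ n → n ⋆ᶜ 1ᶜ ≈ᶜ ι (fromℕ n)
  ⋆1≈ι zero    = refl , refl
  ⋆1≈ι (suc n) with re≈ , im≈ ← ⋆1≈ι n = +-congˡ re≈ , trans (+-identityˡ _) im≈

  ι-cong : ∀ {x y} → x ≈ y → ι x ≈ᶜ ι y
  ι-cong x≈y = x≈y , refl

  ι-homo-* : ∀ x y → ι (x ⊛ y) ≈ᶜ ι x *ᶜ ι y
  ι-homo-* x y =
    sym (x-0*y≈x (x ⊛ y) 0#) , sym (trans (+-cong (zeroʳ x) (zeroˡ y)) (+-identityˡ 0#))

  recip-inverseʳ : ∀ n .{{_ : NonZero n}} → fromℕ n ⊛ recip n ≈ 1#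
  recip-inverseʳ (suc n) = trans (*-comm _ _) (proj₂ (inverse (fromℕ (suc n)) (fromℕ-pos n)))

  invFact-inverseʳ : ∀ n → ((n !) ⋆ᶜ 1ᶜ) *ᶜ ι (invFact n) ≈ᶜ 1ᶜ
  invFact-inverseʳ n = ℂₛ.trans (ℂₛ.*-congʳ (⋆1≈ι (n !)))
    (ℂₛ.trans (ℂₛ.sym (ι-homo-* _ _)) (ι-cong (recip-inverseʳ (n !) {{n ℕ.!≢0}})))

  -- One `N` serves every `ε`: from there on the squared distance is zero, which lies below the
  -- positive `ε ⊛ ε`.
  eventuallyConstant⇒converges : ∀ {s z} N → (∀ n → N ≤ n → s n ≈ᶜ z) → ConvergesToᶜ s z
  eventuallyConstant⇒converges {s} {z} N s≈z ε 0<ε = N , λ n N≤n →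
    <-respˡ-≈ (sym (∣∣²≈0 (s≈z n N≤n))) (*-pos 0<ε 0<ε)
    where
    x-y≈0 : ∀ {x y} → x ≈ y → x - y ≈ 0#
    x-y≈0 x≈y = trans (+-congʳ x≈y) (-‿inverseʳ _)

    ∣∣²≈0 : ∀ {w} → w ≈ᶜ z → normSq (w -ᶜ z) ≈ 0#
    ∣∣²≈0 (re≈ , im≈) =
      trans (+-cong (trans (*-congʳ (x-y≈0 re≈)) (zeroˡ _)) (trans (*-congʳ (x-y≈0 im≈)) (zeroˡ _)))
        (+-identityˡ 0#)

-- Powers and exponential of a multiple of the creation matrix.

module CreationExp {c ℓ₁ ℓ₂ ℓ₃} (R : RealNumbers c ℓ₁ ℓ₂ ℓ₃)
  (a : ComplexAnalysis.ℂ R) (r : ℕ) where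
  open RealProperties R using (invFact)
  open ComplexAnalysis R hiding (i)
  open ComplexProperties R
  open Matrices R
  open Appell ℂ-commutativeSemiring using (appell; appell-expand; sum-zero; sum-single)
  open Mult ℂₛ.semiring using (×1-homo-*)
  open Sum ℂₛ.semiring using (sum-cong-≋)
  open CommutativeSemigroupProperties
    (CommutativeSemiring.*-commutativeSemigroup ℂ-commutativeSemiring)
    using (x∙yz≈y∙xz; xy∙z≈xz∙y)
  open SetoidReasoning ℂ-setoid

  aA : Matrix (suc r)
  aA = scale a (creation r)

  row-zero : ∀ (P : Matrix (suc r)) k → (aA ⊗ P) zero k ≈ᶜ 0ᶜ
  row-zero P k = sum-zero {suc r} _ λ l → ℂₛ.trans (ℂₛ.*-congʳ (ℂₛ.zeroʳ a)) (ℂₛ.zeroˡ (P l k))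

  -- Row `suc j` of the creation matrix has its only nonzero entry in column `inject₁ j`, so
  -- multiplication on the left moves rows of `P` down by one, with a factor.
  row-suc : ∀ (P : Matrix (suc r)) j k →
    (aA ⊗ P) (suc j) k ≈ᶜ (suc (toℕ j) ⋆ᶜ 1ᶜ) *ᶜ (a *ᶜ P (inject₁ j) k)
  row-suc P j k = begin
    (aA ⊗ P) (suc j) k
      ≈⟨ sum-single {suc r} (λ l → aA (suc j) l *ᶜ P l k) (inject₁ j) off ⟩
    a *ᶜ creation r (suc j) (inject₁ j) *ᶜ P (inject₁ j) k
      ≡⟨ ≡.cong (λ b → a *ᶜ b *ᶜ P (inject₁ j) k)
           (if-yes (suc (toℕ j) ≟ suc (toℕ (inject₁ j))) (≡.cong suc (≡.sym (Fin.toℕ-inject₁ j)))) ⟩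
    a *ᶜ (suc (toℕ j) ⋆ᶜ 1ᶜ) *ᶜ P (inject₁ j) k
      ≈⟨ ℂₛ.trans (ℂₛ.*-assoc _ _ _) (x∙yz≈y∙xz _ _ _) ⟩
    (suc (toℕ j) ⋆ᶜ 1ᶜ) *ᶜ (a *ᶜ P (inject₁ j) k) ∎
    where
    off : ∀ l → l ≢ inject₁ j → aA (suc j) l *ᶜ P l k ≈ᶜ 0ᶜ
    off l l≢j = begin
      a *ᶜ creation r (suc j) l *ᶜ P l k
        ≡⟨ ≡.cong (λ b → a *ᶜ b *ᶜ P l k) (if-no (suc (toℕ j) ≟ suc (toℕ l)) λ j≡l →
             l≢j (Fin.toℕ-injective (≡.trans (≡.sym (ℕ.suc-injective j≡l)) (≡.sym (Fin.toℕ-inject₁ j))))) ⟩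
      a *ᶜ 0ᶜ *ᶜ P l k   ≈⟨ ℂₛ.*-congʳ (ℂₛ.zeroʳ a) ⟩
      0ᶜ *ᶜ P l k        ≈⟨ ℂₛ.zeroˡ (P l k) ⟩
      0ᶜ                 ∎

  -- Each factor moves the support down one row, starting from the diagonal of the identity; the top
  -- row becomes zero.
  power-off-diagonal : ∀ m j k → toℕ j ≢ m + toℕ k → power aA m j k ≈ᶜ 0ᶜ
  power-off-diagonal zero    j       k j≢k = ℂₛ.reflexive (if-no (toℕ j ≟ toℕ k) j≢k)
  power-off-diagonal (suc m) zero    k _   = row-zero (power aA m) k
  power-off-diagonal (suc m) (suc j) k j≢m+k = begin
    power aA (suc m) (suc j) k
      ≈⟨ row-suc (power aA m) j k ⟩
    (suc (toℕ j) ⋆ᶜ 1ᶜ) *ᶜ (a *ᶜ power aA m (inject₁ j) k)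
      ≈⟨ ℂₛ.*-congˡ (ℂₛ.*-congˡ (power-off-diagonal m (inject₁ j) k λ j≡m+k →
           j≢m+k (≡.cong suc (≡.trans (≡.sym (Fin.toℕ-inject₁ j)) j≡m+k)))) ⟩
    (suc (toℕ j) ⋆ᶜ 1ᶜ) *ᶜ (a *ᶜ 0ᶜ)
      ≈⟨ ℂₛ.trans (ℂₛ.*-congˡ (ℂₛ.zeroʳ a)) (ℂₛ.zeroʳ _) ⟩
    0ᶜ ∎

  -- Descending from row `k` to row `m + k` collects the factors k+1, ..., k+m. Their product is
  -- written as a binomial coefficient times `m !`, so that the exponential series can cancel `m !`.
  power-diagonal : ∀ m j k → toℕ j ≡ m + toℕ k →
    power aA m j k ≈ᶜ (((m + toℕ k) choose toℕ k * m !) ⋆ᶜ 1ᶜ) *ᶜ a ^ᶜ m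
  power-diagonal zero j k j≡k = begin
    identity j k                                      ≡⟨ if-yes (toℕ j ≟ toℕ k) j≡k ⟩
    1ᶜ                                                ≈⟨ ℂₛ.+-identityʳ 1ᶜ ⟨
    1 ⋆ᶜ 1ᶜ                                           ≡⟨ ≡.cong (_⋆ᶜ 1ᶜ) (≡.trans (ℕ.*-identityʳ _) (nCn≡1 (toℕ k))) ⟨
    (toℕ k choose toℕ k * 1) ⋆ᶜ 1ᶜ                    ≈⟨ ℂₛ.*-identityʳ _ ⟨
    ((toℕ k choose toℕ k * 1) ⋆ᶜ 1ᶜ) *ᶜ a ^ᶜ 0        ∎
  power-diagonal (suc m) (suc j) k j≡m+k = begin
    power aA (suc m) (suc j) k
      ≈⟨ row-suc (power aA m) j k ⟩
    (suc (toℕ j) ⋆ᶜ 1ᶜ) *ᶜ (a *ᶜ power aA m (inject₁ j) k)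
      ≡⟨ ≡.cong (λ n → (n ⋆ᶜ 1ᶜ) *ᶜ (a *ᶜ power aA m (inject₁ j) k)) j≡m+k ⟩
    (suc (m + toℕ k) ⋆ᶜ 1ᶜ) *ᶜ (a *ᶜ power aA m (inject₁ j) k)
      ≈⟨ ℂₛ.*-congˡ (ℂₛ.*-congˡ (power-diagonal m (inject₁ j) k
           (≡.trans (Fin.toℕ-inject₁ j) (ℕ.suc-injective j≡m+k)))) ⟩
    (suc (m + toℕ k) ⋆ᶜ 1ᶜ) *ᶜ (a *ᶜ ((b ⋆ᶜ 1ᶜ) *ᶜ a ^ᶜ m))
      ≈⟨ ℂₛ.*-congˡ (x∙yz≈y∙xz _ _ _) ⟩
    (suc (m + toℕ k) ⋆ᶜ 1ᶜ) *ᶜ ((b ⋆ᶜ 1ᶜ) *ᶜ a ^ᶜ suc m)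
      ≈⟨ ℂₛ.*-assoc _ _ _ ⟨
    (suc (m + toℕ k) ⋆ᶜ 1ᶜ) *ᶜ (b ⋆ᶜ 1ᶜ) *ᶜ a ^ᶜ suc m
      ≈⟨ ℂₛ.*-congʳ (×1-homo-* (suc (m + toℕ k)) b) ⟨
    ((suc (m + toℕ k) * b) ⋆ᶜ 1ᶜ) *ᶜ a ^ᶜ suc m
      ≡⟨ ≡.cong (λ n → (n ⋆ᶜ 1ᶜ) *ᶜ a ^ᶜ suc m) (choose-*-!-suc m (toℕ k)) ⟩
    ((suc (m + toℕ k) choose toℕ k * suc m !) ⋆ᶜ 1ᶜ) *ᶜ a ^ᶜ suc m ∎
    where b = (m + toℕ k) choose toℕ k * m !

  -- The generalised Pascal matrix, the closed form of the exponential. Above the diagonal the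
  -- truncated exponent is `0`, and it is the binomial coefficient that makes the entry vanish.
  pascal : Matrix (suc r)
  pascal j k = ((toℕ j choose toℕ k) ⋆ᶜ 1ᶜ) *ᶜ a ^ᶜ (toℕ j ∸ toℕ k)

  expTerm : Fin (suc r) → Fin (suc r) → ℕ → ℂ
  expTerm j k m = power aA m j k *ᶜ ι (invFact m)

  expTerm-off-diagonal : ∀ j k m → toℕ j ≢ m + toℕ k → expTerm j k m ≈ᶜ 0ᶜ
  expTerm-off-diagonal j k m j≢m+k =
    ℂₛ.trans (ℂₛ.*-congʳ (power-off-diagonal m j k j≢m+k)) (ℂₛ.zeroˡ _)

  expTerm-diagonal : ∀ j k m → toℕ j ≡ m + toℕ k → expTerm j k m ≈ᶜ pascal j k
  expTerm-diagonal j k m j≡m+k = begin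
    power aA m j k *ᶜ ι (invFact m)
      ≈⟨ ℂₛ.*-congʳ (power-diagonal m j k j≡m+k) ⟩
    ((b * m !) ⋆ᶜ 1ᶜ) *ᶜ a ^ᶜ m *ᶜ ι (invFact m)
      ≈⟨ xy∙z≈xz∙y _ _ _ ⟩
    ((b * m !) ⋆ᶜ 1ᶜ) *ᶜ ι (invFact m) *ᶜ a ^ᶜ m
      ≈⟨ ℂₛ.*-congʳ (ℂₛ.*-congʳ (×1-homo-* b (m !))) ⟩
    (b ⋆ᶜ 1ᶜ) *ᶜ ((m !) ⋆ᶜ 1ᶜ) *ᶜ ι (invFact m) *ᶜ a ^ᶜ m
      ≈⟨ ℂₛ.*-congʳ (ℂₛ.*-assoc _ _ _) ⟩
    (b ⋆ᶜ 1ᶜ) *ᶜ (((m !) ⋆ᶜ 1ᶜ) *ᶜ ι (invFact m)) *ᶜ a ^ᶜ m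
      ≈⟨ ℂₛ.*-congʳ (ℂₛ.trans (ℂₛ.*-congˡ (invFact-inverseʳ m)) (ℂₛ.*-identityʳ _)) ⟩
    (b ⋆ᶜ 1ᶜ) *ᶜ a ^ᶜ m
      ≡⟨ ≡.cong₂ (λ n l → ((n choose toℕ k) ⋆ᶜ 1ᶜ) *ᶜ a ^ᶜ l) j≡m+k
           (≡.trans (≡.cong (_∸ toℕ k) j≡m+k) (ℕ.m+n∸n≡m m (toℕ k))) ⟨
    pascal j k ∎
    where b = (m + toℕ k) choose toℕ k

  -- At most one term of the series contributes to entry `j`, `k`, the one with m = j - k. As j - k
  -- is at most `r`, the first `suc r` terms suffice for all entries at once.
  pascal-isMatrixExp : IsMatrixExp aA pascal
  pascal-isMatrixExp j k = eventuallyConstant⇒converges (suc r) partialSum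
    where
    partialSum : ∀ N → suc r ≤ N → sumᶜ {N} (expTerm j k ∘ toℕ) ≈ᶜ pascal j k
    partialSum N r<N with toℕ k ≤? toℕ j
    ... | yes k≤j = begin
      sumᶜ {N} (expTerm j k ∘ toℕ)   ≈⟨ sum-single {N} (expTerm j k ∘ toℕ) i off ⟩
      expTerm j k (toℕ i)            ≈⟨ expTerm-diagonal j k (toℕ i)
           (≡.sym (≡.trans (≡.cong (_+ toℕ k) i≡j-k) (ℕ.m∸n+n≡m k≤j))) ⟩
      pascal j k                     ∎
      where
      j-k<N : toℕ j ∸ toℕ k < N
      j-k<N = ℕ.≤-<-trans (ℕ.m∸n≤m (toℕ j) (toℕ k)) (ℕ.<-≤-trans (Fin.toℕ<n j) r<N)
      i : Fin N
      i = fromℕ< j-k<N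
      i≡j-k : toℕ i ≡ toℕ j ∸ toℕ k
      i≡j-k = Fin.toℕ-fromℕ< j-k<N
      off : ∀ m → m ≢ i → expTerm j k (toℕ m) ≈ᶜ 0ᶜ
      off m m≢i = expTerm-off-diagonal j k (toℕ m) λ j≡m+k → m≢i (Fin.toℕ-injective (≡.sym
        (≡.trans i≡j-k (≡.trans (≡.cong (_∸ toℕ k) j≡m+k) (ℕ.m+n∸n≡m (toℕ m) (toℕ k))))))
    -- Above the diagonal no `m` satisfies `toℕ j ≡ m + toℕ k`, so every term is zero.
    ... | no k≰j = begin
      sumᶜ {N} (expTerm j k ∘ toℕ)
        ≈⟨ sum-zero {N} (expTerm j k ∘ toℕ) (λ m → expTerm-off-diagonal j k (toℕ m) λ j≡m+k →
             k≰j (≡.subst (toℕ k ≤_) (≡.sym j≡m+k) (ℕ.m≤n+m (toℕ k) (toℕ m)))) ⟩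
      0ᶜ
        ≈⟨ ℂₛ.zeroˡ _ ⟨
      (0 ⋆ᶜ 1ᶜ) *ᶜ a ^ᶜ (toℕ j ∸ toℕ k)
        ≡⟨ ≡.cong (λ b → (b ⋆ᶜ 1ᶜ) *ᶜ a ^ᶜ (toℕ j ∸ toℕ k)) (k>n⇒nCk≡0 (ℕ.≰⇒> k≰j)) ⟨
      pascal j k ∎

  -- Row `n` holds the coefficients of the binomial transform; the columns beyond `n` contribute
  -- zero.
  apply-pascal : ∀ (h : ℕ → ℂ) n →
    apply pascal (h ∘ toℕ) n ≈ᶜ appell a h (toℕ n)
  apply-pascal h n = ℂₛ.trans
    (sum-cong-≋ {suc r} λ k →
      xy∙z≈xz∙y ((toℕ n choose toℕ k) ⋆ᶜ 1ᶜ) (a ^ᶜ (toℕ n ∸ toℕ k)) (h (toℕ k)))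
    (ℂₛ.sym (appell-expand a h {toℕ n} (Fin.toℕ<n n)))

-- Translation of the Hecke vector-form.

theorem1 : ∀ {c ℓ₁ ℓ₂ ℓ₃} (R : RealNumbers c ℓ₁ ℓ₂ ℓ₃) →
    let open RealNumbers R using (ℝ)
        open RealAnalysis R using (IsPi)
        open ComplexAnalysis R
        open Matrices R
    in
    (μ : ℕ) .{{_ : NonZero μ}} → 3 ≤ μ →
    (π ϖ : ℝ) → IsPi π → IsHeckeWidth R μ π ϖ →
    let open HeckeTriangle R π ϖ in
    (𝓔 : EisensteinSeries₂) →
    (w r : ℕ) → 2 ≤ w → 2 ∣ w → 2 * r ≤ w →
    (𝓤 : QuasiautomorphicForm 𝓔 w r) →
    Σ[ X ∈ Matrix (suc r) ] IsMatrixExp (scale (ι ϖ) (creation r)) X ×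
      (∀ (z : ℍ) n → heckeVectorForm 𝓔 𝓤 (T z) n ≈ᶜ apply X (heckeVectorForm 𝓔 𝓤 z) n)
theorem1 R μ _ π ϖ _ _ 𝓔 w r _ _ _ 𝓤 = pascal , pascal-isMatrixExp , F-T
  where
  open ComplexAnalysis R hiding (i)
  open Matrices R
  open HeckeTriangle R π ϖ
  open EisensteinSeries₂ 𝓔 using (C; T-periodic)
  open QuasiautomorphicForm 𝓤 using (form)
  open ComplexProperties R
  open Appell ℂ-commutativeSemiring
  open CreationExp R (ι ϖ) r
  open Exp ℂₛ.semiring using (^-congˡ)
  open Sum ℂₛ.semiring using (sum-cong-≋)
  open SetoidReasoning ℂ-setoid

  -- `g` is a polynomial with constant coefficients in `E₂` and the automorphic coefficients of `𝓤`,
  -- all of which are invariant under `T`.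
  g-T-invariant : ∀ ℓ z → g 𝓔 𝓤 ℓ (T z) ≈ᶜ g 𝓔 𝓤 ℓ z
  g-T-invariant ℓ z = ℂₛ.*-congˡ {C ^ᶜ toℕ ℓ} (sum-cong-≋ λ m → ℂₛ.*-cong
    (ℂₛ.*-congˡ {ι (coefficient 𝓔 r (toℕ ℓ) (toℕ m))} (AutomorphicForm.T-invariant (form (shift 𝓔 ℓ m)) z))
    (^-congˡ (toℕ m) (T-periodic z)))

  -- The value of `appell` at `n` depends only on entries `0` to `n`, so the padding beyond `r` does
  -- not affect the components of the vector-form.
  ĝ : ℍ → ℕ → ℂ
  ĝ z = extend 0ᶜ (λ ℓ → g 𝓔 𝓤 ℓ z)

  ĝ-T-invariant : ∀ z k → ĝ (T z) k ≈ᶜ ĝ z k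
  ĝ-T-invariant z = extend-cong _ _ λ ℓ → g-T-invariant ℓ z
    where
    extend-cong : ∀ {n} (v v′ : Vector ℂ n) → (∀ i → v i ≈ᶜ v′ i) →
      ∀ k → extend 0ᶜ v k ≈ᶜ extend 0ᶜ v′ k
    extend-cong {zero}  _ _ _    _       = ℂₛ.refl
    extend-cong {suc _} _ _ v≈v′ zero    = v≈v′ zero
    extend-cong {suc _} _ _ v≈v′ (suc k) = extend-cong _ _ (v≈v′ ∘ suc) k

  f-appell : ∀ z n → f 𝓔 𝓤 n z ≈ᶜ appell (proj₁ z) (ĝ z) (toℕ n)
  f-appell z n = ℂₛ.trans
    (sum-cong-≋ {suc (toℕ n)} λ k → ℂₛ.*-congʳ {proj₁ z ^ᶜ (toℕ n ∸ toℕ k)}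
      (ℂₛ.*-congˡ {(toℕ n choose toℕ k) ⋆ᶜ 1ᶜ} (ℂₛ.reflexive (g≡ĝ k))))
    (ℂₛ.sym (appell-expand (proj₁ z) (ĝ z) {toℕ n} ℕ.≤-refl))
    where
    g≡ĝ : ∀ (k : Fin (suc (toℕ n))) → g 𝓔 𝓤 (inject≤ k (Fin.toℕ<n n)) z ≡ ĝ z (toℕ k)
    g≡ĝ k = ≡.trans (≡.sym (extend-toℕ 0ᶜ _ (inject≤ k (Fin.toℕ<n n))))
      (≡.cong (ĝ z) (Fin.toℕ-inject≤ k (Fin.toℕ<n n)))

  F-T : ∀ z n → heckeVectorForm 𝓔 𝓤 (T z) n ≈ᶜ apply pascal (heckeVectorForm 𝓔 𝓤 z) n
  F-T z n = begin
    f 𝓔 𝓤 n (T z)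
      ≈⟨ f-appell (T z) n ⟩
    -- The underlying complex number of `T z` is `proj₁ z +ᶜ ι ϖ` by definition.
    appell (proj₁ z +ᶜ ι ϖ) (ĝ (T z)) (toℕ n)
      ≈⟨ appell-cong ℂₛ.refl (ĝ-T-invariant z) (toℕ n) ⟩
    appell (proj₁ z +ᶜ ι ϖ) (ĝ z) (toℕ n)
      -- The translation by `ϖ` separates from `z` as an outer binomial transform, which is the
      -- action of `pascal`.
      ≈⟨ appell-∘ (ι ϖ) (proj₁ z) (ĝ z) (toℕ n) ⟨
    appell (ι ϖ) (appell (proj₁ z) (ĝ z)) (toℕ n)
      ≈⟨ apply-pascal (appell (proj₁ z) (ĝ z)) n ⟨
    apply pascal (λ k → appell (proj₁ z) (ĝ z) (toℕ k)) n
      ≈⟨ sum-cong-≋ {suc r} (λ k → ℂₛ.*-congˡ {pascal n k} (f-appell z k)) ⟨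
    apply pascal (heckeVectorForm 𝓔 𝓤 z) n ∎
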